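{- (Completeness) Let $\mathfrak M=(\mathfrak T,\mathcal V)$ be a TFL model and $\phi$ a TFL formula in positive normal form, and let $H_0=(\mathfrak X(s_0),t_\epsilon)$ be the initial process. If $H_0\in[\![\phi]\!]^{\mathfrak T}_{\mathcal V}$, then Eve has a winning strategy in the model-checking game $\mathcal G(H_0,\phi)$.
   Context: Systems: $\mathfrak T=(S,s_0,T,I,\Sigma)$, a transition system with independence (states $S$, initial $s_0$, labels $\Sigma$, transitions $T\subseteq S\times\Sigma\times S$, irreflexive symmetric independence $I\subseteq T\times T$ satisfying the standard TSI axioms), image-finite. For $t=(s,a,s')$: $\sigma(t)=s,\tau(t)=s',\delta(t)=a$. $t\otimes t'$ iff $\sigma(t)=\sigma(t')\wedge tIt'$; $t\ominus t'$ iff $\tau(t)=\sigma(t')\wedge tIt'$; $t\le t'$ iff $\tau(t)=\sigma(t')\wedge\neg tIt'$. $\mathfrak X(s)$ = transitions with source $s$; conflict-free set = set with common source, pairwise $\otimes$; support sets = the $\mathfrak X(s)$ and non-empty conflict-free sets; $M\sqsubseteq R$ iff $M\subseteq R$ and no $t\in R\setminus M$ has $t\otimes t'$ for all $t'\in M$; $\mathcal X$ = all $\mathfrak X(s)$ and all support sets $M\sqsubseteq\mathfrak X(s)$; $\mathfrak A=T\cup\{t_\epsilon\}$ with fresh $t_\epsilon$, $\tau(t_\epsilon)=s_0$, $t_\epsilon\le t$ whenever $\sigma(t)=s_0$, never $t_\epsilon\ominus t$; processes $\mathfrak S=\mathcal X\times\mathfrak A$. TFL: formulas $\phi::=Z\mid\neg\phi\mid\phi\wedge\phi\mid\langle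 a\rangle_c\phi\mid\langle a\rangle_{nc}\phi\mid\langle\otimes\rangle\phi\mid\mu Z.\phi$ (free occurrences of $Z$ in $\mu Z.\phi$ under an even number of negations), with duals $\vee$, $[a]_c=\neg\langle a\rangle_c\neg$, $[a]_{nc}$, $[\otimes]=\neg\langle\otimes\rangle\neg$, $\nu Z.\phi=\neg\mu Z.\neg\phi[\neg Z/Z]$. A model is $(\mathfrak T,\mathcal V)$ with $\mathcal V:\mathrm{Var}\to2^{\mathfrak S}$. Semantics in $2^{\mathfrak S}$: $[\![Z]\!]=\mathcal V(Z)$, $\neg$ complement, $\wedge$ intersection, $[\![\langle a\rangle_c\phi]\!]=\{(R,t):\exists r\in R.\ \delta(r)=a,\ t\le r,\ (\mathfrak X(\tau(r)),r)\in[\![\phi]\!]\}$, $\langle a\rangle_{nc}$ likewise with $t\ominus r$, $[\![\langle\otimes\rangle\phi]\!]=\{(R,t):\exists M\in\mathcal X.\ M\sqsubseteq R,\ (M,t)\in[\![\phi]\!]\}$, $[\![\mu Z.\phi]\!]_{\mathcal V}=\bigcap\{Q\subseteq\mathfrak S:[\![\phi]\!]_{\mathcal V[Z:=Q]}\subseteq Q\}$. Positive normal form: negation only on variables, no two binders bind the same variable. $Sub(\phi)$ is the set of subformulas. Model-checking game $\mathcal G(H_0,\phi)$ between Eve and Adam: configurations $H\vdash\psi$ with $H\in\mathfrak S$, $\psi\in Sub(\phi)$; start $H_0\vdash\phi$. Rules: $H\vdash\mu Z.\psi$ or $H\vdash\nu Z.\psi$ moves to $H\vdash Z$; $H\vdash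 Z$ with $Z$ bound by $\mu Z.\psi$ or $\nu Z.\psi$ moves to $H\vdash\psi$; at $H\vdash\psi_0\vee\psi_1$ Eve (at $\wedge$, Adam) chooses $H\vdash\psi_i$; at $(R,t)\vdash\langle a\rangle_c\psi$ Eve (at $[a]_c\psi$, Adam) chooses $r\in R$ with $\delta(r)=a$, $t\le r$, moving to $(\mathfrak X(\tau(r)),r)\vdash\psi$; same for $\langle a\rangle_{nc}$/$[a]_{nc}$ with $t\ominus r$; at $(R,t)\vdash\langle\otimes\rangle\psi$ Eve (at $[\otimes]\psi$, Adam) chooses $M\in\mathcal X$ with $M\sqsubseteq R$, moving to $(M,t)\vdash\psi$. Adam wins a play iff it ends at $H\vdash Z$ ($Z$ free) with $H\notin\mathcal V(Z)$, or at a diamond configuration ($\langle a\rangle_c$, $\langle a\rangle_{nc}$, $\langle\otimes\rangle$) with no available choice, or is infinite and the syntactically outermost variable occurring infinitely often is bound by a $\mu$; Eve wins dually (ends at $H\vdash Z$ with $H\in\mathcal V(Z)$, at a box configuration with no available choice, or infinite with the outermost infinitely-often variable bound by a $\nu$). A player has a winning strategy if she/he can guarantee winning every play.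
   Formalization: Positive normal form is also taken to require that no variable occurs both free and bound in the formula; otherwise the rules for bound and free Z conflict, as in Z ∨ μZ.Z with the initial process in V(Z). -}

module Defs where

open import Axiom.ExcludedMiddle using (ExcludedMiddle)
open import Data.Bool.Base using (Bool; T; if_then_else_)
open import Data.Empty using (⊥)
open import Data.Irrelevant using () renaming ([_] to irr)
open import Data.List.Base using (List; []; _∷_; _++_; applyDownFrom)
import Data.List.Membership.Propositional as List
open import Data.List.Relation.Unary.Unique.Propositional using (Unique)
open import Data.Nat.Base as ℕ using (ℕ; suc)
open import Data.Parity.Base using (Parity; 0ℙ; _⁻¹)
open import Data.Product.Base using (_×_; _,_; proj₁; proj₂; ∃; ∃-syntax)
open import Data.Refinement.Base using (Refinement; Refinement-syntax; value; _,_)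
open import Data.Sum.Base using (_⊎_; inj₁)
open import Data.Unit.Base using (⊤)
open import Level using (0ℓ)
open import Relation.Binary.Construct.Closure.Equivalence using (EqClosure)
open import Relation.Binary.Construct.Closure.Symmetric using (SymClosure)
open import Relation.Binary.Core using (Rel)
open import Relation.Binary.Definitions using (Irreflexive; Symmetric)
open import Relation.Binary.PropositionalEquality.Core using (_≡_; _≢_; _≗_; refl)
open import Relation.Nullary.Decidable.Core using (⌊_⌋)
open import Relation.Nullary.Negation.Core using (¬_)
open import Relation.Unary using (Pred) renaming (_∈_ to _∈ᴾ_)

data Diamond {S Σ : Set} (_I_ : Rel (S × Σ × S) 0ℓ) : Rel (S × Σ × S) 0ℓ where
  diamond : ∀ {s s₁ s₂ q a b} →
            (s , a , s₁) I (s , b , s₂) →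
            (s , a , s₁) I (s₁ , b , q) →
            (s , b , s₂) I (s₂ , a , q) →
            Diamond _I_ (s , a , s₁) (s₂ , a , q)

record TSI (Σ : Set) : Set₁ where
  field
    S    : Set
    s₀   : S
    Tr   : Pred (S × Σ × S) 0ℓ
    _I_  : Rel (S × Σ × S) 0ℓ

  _≺_ : Rel (S × Σ × S) 0ℓ
  _≺_ = Diamond _I_

  _∼_ : Rel (S × Σ × S) 0ℓ
  _∼_ = EqClosure _≺_

  field
    I⊆Tr×Tr : ∀ {t u} → t I u → t ∈ᴾ Tr × u ∈ᴾ Tr
    I-irrefl : Irreflexive _≡_ _I_
    I-sym    : Symmetric _I_

    A1 : ∀ {s a s₁ s₂} → (s , a , s₁) ∼ (s , a , s₂) → s₁ ≡ s₂
    A2 : ∀ {s a b s₁ s₂} → (s , a , s₁) I (s , b , s₂) →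
         ∃[ q ] (s , a , s₁) I (s₁ , b , q) × (s , b , s₂) I (s₂ , a , q)
    A3 : ∀ {s a b s₁ q} → (s , a , s₁) I (s₁ , b , q) →
         ∃[ s₂ ] (s , a , s₁) I (s , b , s₂) × (s , b , s₂) I (s₂ , a , q)
    A4 : ∀ {t u w} → SymClosure _≺_ t u → u I w → t I w

ImageFinite : ∀ {Σ} → TSI Σ → Set
ImageFinite 𝔗 = ∀ s a → ∃[ ss ] (∀ {s′} → (s , a , s′) ∈ᴾ Tr → s′ List.∈ ss)
  where open TSI 𝔗

data Modality (Σ : Set) : Set where
  c nc : Σ → Modality Σ
  ⊗    : Modality Σ

data TFL (Var Σ : Set) : Set where
  var   : Var → TFL Var Σ
  ¬̇_    : TFL Var Σ → TFL Var Σ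
  _∧_   : TFL Var Σ → TFL Var Σ → TFL Var Σ
  ⟨_⟩_  : Modality Σ → TFL Var Σ → TFL Var Σ
  μ_∙_  : Var → TFL Var Σ → TFL Var Σ

-- Formulas with the duals as connectives and negation only on variables.
data Positive (Var Σ : Set) : Set where
  var     : Var → Positive Var Σ
  ¬̇var    : Var → Positive Var Σ
  _∧_ _∨_ : Positive Var Σ → Positive Var Σ → Positive Var Σ
  ⟨_⟩_    : Modality Σ → Positive Var Σ → Positive Var Σ
  [_]_    : Modality Σ → Positive Var Σ → Positive Var Σ
  μ_∙_    : Var → Positive Var Σ → Positive Var Σ
  ν_∙_    : Var → Positive Var Σ → Positive Var Σ

infixr 8 ¬̇_ ⟨_⟩_ [_]_ μ_∙_ ν_∙_
infixr 7 _∧_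
infixr 6 _∨_

module _ {Var Σ : Set} where

  -- Every free occurrence of Z in the formula lies under a number of
  -- negations of parity p.
  Occurs : Parity → Var → TFL Var Σ → Set
  Occurs p Z (var X)   = X ≡ Z → p ≡ 0ℙ
  Occurs p Z (¬̇ φ)     = Occurs (p ⁻¹) Z φ
  Occurs p Z (φ ∧ ψ)   = Occurs p Z φ × Occurs p Z ψ
  Occurs p Z (⟨ m ⟩ φ) = Occurs p Z φ
  Occurs p Z (μ X ∙ φ) = X ≢ Z → Occurs p Z φ

  WellFormed : TFL Var Σ → Set
  WellFormed (var Z)   = ⊤
  WellFormed (¬̇ φ)     = WellFormed φ
  WellFormed (φ ∧ ψ)   = WellFormed φ × WellFormed ψ
  WellFormed (⟨ m ⟩ φ) = WellFormed φ
  WellFormed (μ Z ∙ φ) = Occurs 0ℙ Z φ × WellFormed φ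

  Sub : Positive Var Σ → List (Positive Var Σ)
  Sub φ@(var Z)   = φ ∷ []
  Sub φ@(¬̇var Z)  = φ ∷ var Z ∷ []
  Sub φ@(ψ ∧ χ)   = φ ∷ Sub ψ ++ Sub χ
  Sub φ@(ψ ∨ χ)   = φ ∷ Sub ψ ++ Sub χ
  Sub φ@(⟨ m ⟩ ψ) = φ ∷ Sub ψ
  Sub φ@([ m ] ψ) = φ ∷ Sub ψ
  Sub φ@(μ Z ∙ ψ) = φ ∷ Sub ψ
  Sub φ@(ν Z ∙ ψ) = φ ∷ Sub ψ

  -- One entry per binder, so a repetition means two binders of one variable.
  bound : Positive Var Σ → List Var
  bound (var Z)   = []
  bound (¬̇var Z)  = []
  bound (φ ∧ ψ)   = bound φ ++ bound ψ
  bound (φ ∨ ψ)   = bound φ ++ bound ψ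
  bound (⟨ m ⟩ φ) = bound φ
  bound ([ m ] φ) = bound φ
  bound (μ Z ∙ φ) = Z ∷ bound φ
  bound (ν Z ∙ φ) = Z ∷ bound φ

  Free : Var → Positive Var Σ → Set
  Free X (var Z)   = X ≡ Z
  Free X (¬̇var Z)  = X ≡ Z
  Free X (φ ∧ ψ)   = Free X φ ⊎ Free X ψ
  Free X (φ ∨ ψ)   = Free X φ ⊎ Free X ψ
  Free X (⟨ m ⟩ φ) = Free X φ
  Free X ([ m ] φ) = Free X φ
  Free X (μ Z ∙ φ) = X ≢ Z × Free X φ
  Free X (ν Z ∙ φ) = X ≢ Z × Free X φ

  -- ψ is the body of a binder of Z, and χ the whole fixpoint formula.
  data Binding (Z : Var) (ψ : Positive Var Σ) : (χ : Positive Var Σ) → Set where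
    μ-binds : Binding Z ψ (μ Z ∙ ψ)
    ν-binds : Binding Z ψ (ν Z ∙ ψ)

-- The logic lives in classical set theory.  Excluded middle makes the maps
-- A → Bool all the subsets of A; since these maps form a small type, the
-- intersection over all Q ⊆ 𝔖 defining μ is again a subset of 𝔖.

module Classical (em : ExcludedMiddle 0ℓ) where

  𝒫 : Set → Set
  𝒫 A = A → Bool

  module _ {A : Set} where
    infix 4 _∈_ _∉_ _⊆_

    _∈_ _∉_ : A → 𝒫 A → Set
    x ∈ M = T (M x)
    x ∉ M = ¬ x ∈ M

    _⊆_ : 𝒫 A → 𝒫 A → Set
    M ⊆ N = ∀ {x} → x ∈ M → x ∈ N

    ⁅_⁆ : Pred A 0ℓ → 𝒫 A
    ⁅ P ⁆ x = ⌊ em {P x} ⌋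

  module Processes {Σ : Set} (𝔗 : TSI Σ) where
    open TSI 𝔗

    Transition : Set
    Transition = [ t ∈ S × Σ × S ∣ t ∈ᴾ Tr ]

    src tgt : Transition → S
    src t = proj₁ (value t)
    tgt t = proj₂ (proj₂ (value t))

    δ : Transition → Σ
    δ t = proj₁ (proj₂ (value t))

    _⊗ₜ_ : Rel Transition 0ℓ
    t ⊗ₜ u = src t ≡ src u × value t I value u

    data 𝔄 : Set where
      tε : 𝔄
      ↑_ : Transition → 𝔄

    τ : 𝔄 → S
    τ tε    = s₀
    τ (↑ t) = tgt t

    _⊖_ : 𝔄 → Transition → Set
    tε    ⊖ u = ⊥
    (↑ t) ⊖ u = tgt t ≡ src u × value t I value u

    _≤_ : 𝔄 → Transition → Set
    tε    ≤ u = src u ≡ s₀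
    (↑ t) ≤ u = tgt t ≡ src u × ¬ value t I value u

    𝔛 : S → 𝒫 Transition
    𝔛 s = ⁅ (λ t → src t ≡ s) ⁆

    -- I is irreflexive, so "pairwise" concerns distinct transitions.
    ConflictFree : 𝒫 Transition → Set
    ConflictFree M = (∃[ s ] (∀ {t} → t ∈ M → src t ≡ s)) ×
                     (∀ {t u} → t ∈ M → u ∈ M → t ≢ u → t ⊗ₜ u)

    Support : 𝒫 Transition → Set
    Support M = (∃[ s ] M ≗ 𝔛 s) ⊎ (∃ (_∈ M) × ConflictFree M)

    _⊑_ : Rel (𝒫 Transition) 0ℓ
    M ⊑ R = M ⊆ R ×
            ¬ (∃[ t ] t ∈ R × t ∉ M × (∀ {u} → u ∈ M → t ⊗ₜ u))

    𝒳 : Set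
    𝒳 = [ M ∈ 𝒫 Transition ∣ (∃[ s ] M ≗ 𝔛 s) ⊎ (∃[ s ] Support M × M ⊑ 𝔛 s) ]

    𝔛′ : S → 𝒳
    𝔛′ s = 𝔛 s , irr (inj₁ (s , λ _ → refl))

    𝔖 : Set
    𝔖 = 𝒳 × 𝔄

    initial : 𝔖
    initial = 𝔛′ s₀ , tε

    -- H —[ m ]→ H′: the process H′ is a witness for ⟨ m ⟩ at H.
    data _—[_]→_ : 𝔖 → Modality Σ → 𝔖 → Set where
      causal     : ∀ {R t} r → r ∈ value R → t ≤ r →
                   (R , t) —[ c (δ r) ]→ (𝔛′ (tgt r) , ↑ r)
      concurrent : ∀ {R t} r → r ∈ value R → t ⊖ r →
                   (R , t) —[ nc (δ r) ]→ (𝔛′ (tgt r) , ↑ r)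
      restrict   : ∀ {R t} (M : 𝒳) → value M ⊑ value R →
                   (R , t) —[ ⊗ ]→ (M , t)

  record Model (Var Σ : Set) : Set₁ where
    field
      𝔗           : TSI Σ
      imageFinite : ImageFinite 𝔗
    open Processes 𝔗 public
    field
      𝒱 : Var → 𝒫 𝔖

  module _ {Var Σ : Set} where

    -- φ ⟪¬ Z ⟫ is φ[¬Z/Z].  Renaming is never needed: a binder capturing
    -- the new Z binds the old Z too.
    _⟪¬_⟫ : TFL Var Σ → Var → TFL Var Σ
    var X     ⟪¬ Z ⟫ = if ⌊ em {X ≡ Z} ⌋ then ¬̇ var X else var X
    (¬̇ φ)     ⟪¬ Z ⟫ = ¬̇ (φ ⟪¬ Z ⟫)
    (φ ∧ ψ)   ⟪¬ Z ⟫ = (φ ⟪¬ Z ⟫) ∧ (ψ ⟪¬ Z ⟫)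
    (⟨ m ⟩ φ) ⟪¬ Z ⟫ = ⟨ m ⟩ (φ ⟪¬ Z ⟫)
    (μ X ∙ φ) ⟪¬ Z ⟫ = if ⌊ em {X ≡ Z} ⌋ then μ X ∙ φ else μ X ∙ (φ ⟪¬ Z ⟫)

    -- The formula abbreviated by one written with the duals.
    expand : Positive Var Σ → TFL Var Σ
    expand (var Z)   = var Z
    expand (¬̇var Z)  = ¬̇ var Z
    expand (φ ∧ ψ)   = expand φ ∧ expand ψ
    expand (φ ∨ ψ)   = ¬̇ (¬̇ expand φ ∧ ¬̇ expand ψ)
    expand (⟨ m ⟩ φ) = ⟨ m ⟩ expand φ
    expand ([ m ] φ) = ¬̇ ⟨ m ⟩ ¬̇ expand φ
    expand (μ Z ∙ φ) = μ Z ∙ expand φ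
    expand (ν Z ∙ φ) = ¬̇ μ Z ∙ ¬̇ (expand φ ⟪¬ Z ⟫)

    record PositiveNormalForm (φ : Positive Var Σ) : Set where
      field
        wellFormed      : WellFormed (expand φ)
        distinctBinders : Unique (bound φ)
        -- Without this, "Z is bound by …" and "Z is free" would not be
        -- exclusive at a configuration H ⊢ Z.
        freeNotBound    : ∀ {Z} → Free Z φ → ¬ Z List.∈ bound φ

  module Semantics (Var : Set) {Σ : Set} (𝔗 : TSI Σ) where
    open Processes 𝔗

    _[_:=_] : (Var → 𝒫 𝔖) → Var → 𝒫 𝔖 → (Var → 𝒫 𝔖)
    (𝒱 [ Z := Q ]) X = if ⌊ em {X ≡ Z} ⌋ then Q else 𝒱 X

    ⟦_⟧ : TFL Var Σ → (Var → 𝒫 𝔖) → 𝒫 𝔖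
    ⟦ var Z ⟧   𝒱 = 𝒱 Z
    ⟦ ¬̇ φ ⟧     𝒱 = ⁅ (λ H → H ∉ ⟦ φ ⟧ 𝒱) ⁆
    ⟦ φ ∧ ψ ⟧   𝒱 = ⁅ (λ H → H ∈ ⟦ φ ⟧ 𝒱 × H ∈ ⟦ ψ ⟧ 𝒱) ⁆
    ⟦ ⟨ m ⟩ φ ⟧ 𝒱 = ⁅ (λ H → ∃[ H′ ] H —[ m ]→ H′ × H′ ∈ ⟦ φ ⟧ 𝒱) ⁆
    ⟦ μ Z ∙ φ ⟧ 𝒱 = ⁅ (λ H → ∀ Q → ⟦ φ ⟧ (𝒱 [ Z := Q ]) ⊆ Q → H ∈ Q) ⁆

  module Game {Var Σ : Set} (𝔐 : Model Var Σ)
              (H₀ : Model.𝔖 𝔐) (φ : Positive Var Σ) where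
    open Model 𝔐

    -- Every configuration of a play from H₀ ⊢ φ has its formula in Sub φ.
    infix 3 _⊢_
    data Config : Set where
      _⊢_ : 𝔖 → Positive Var Σ → Config

    infix 2 _⟶_
    data _⟶_ : Config → Config → Set where
      μ-step  : ∀ {H Z ψ} → H ⊢ μ Z ∙ ψ ⟶ H ⊢ var Z
      ν-step  : ∀ {H Z ψ} → H ⊢ ν Z ∙ ψ ⟶ H ⊢ var Z
      unfold  : ∀ {H Z ψ χ} → Binding Z ψ χ → χ List.∈ Sub φ →
                H ⊢ var Z ⟶ H ⊢ ψ
      ∨-left  : ∀ {H ψ₀ ψ₁} → H ⊢ ψ₀ ∨ ψ₁ ⟶ H ⊢ ψ₀
      ∨-right : ∀ {H ψ₀ ψ₁} → H ⊢ ψ₀ ∨ ψ₁ ⟶ H ⊢ ψ₁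
      ∧-left  : ∀ {H ψ₀ ψ₁} → H ⊢ ψ₀ ∧ ψ₁ ⟶ H ⊢ ψ₀
      ∧-right : ∀ {H ψ₀ ψ₁} → H ⊢ ψ₀ ∧ ψ₁ ⟶ H ⊢ ψ₁
      ◇-step  : ∀ {H H′ m ψ} → H —[ m ]→ H′ → H ⊢ ⟨ m ⟩ ψ ⟶ H′ ⊢ ψ
      □-step  : ∀ {H H′ m ψ} → H —[ m ]→ H′ → H ⊢ [ m ] ψ ⟶ H′ ⊢ ψ

    CanMove : Config → Set
    CanMove C = ∃ (C ⟶_)

    data EveChooses : Config → Set where
      at-∨ : ∀ {H ψ₀ ψ₁} → EveChooses (H ⊢ ψ₀ ∨ ψ₁)
      at-◇ : ∀ {H m ψ} → EveChooses (H ⊢ ⟨ m ⟩ ψ)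

    -- Outcome of a play ending at the given configuration; a play can end
    -- at a variable only if that variable is free in φ.
    data EveWinsAt : Config → Set where
      at-var  : ∀ {H Z} → H ∈ 𝒱 Z → EveWinsAt (H ⊢ var Z)
      at-¬var : ∀ {H Z} → H ∉ 𝒱 Z → EveWinsAt (H ⊢ ¬̇var Z)
      at-□    : ∀ {H m ψ} → EveWinsAt (H ⊢ [ m ] ψ)

    InfinitelyOften : (ℕ → Config) → Var → Set
    InfinitelyOften π Z = ∀ n → ∃[ k ] n ℕ.≤ k × ∃[ H ] π k ≡ (H ⊢ var Z)

    -- Z is syntactically outermost: its fixpoint formula contains that of
    -- every variable occurring infinitely often.
    EveWinsInfinite : (ℕ → Config) → Set
    EveWinsInfinite π =
      ∃[ Z ] ∃[ ψ ] (ν Z ∙ ψ) List.∈ Sub φ × InfinitelyOften π Z ×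
        (∀ {Y θ χ} → InfinitelyOften π Y → Binding Y θ χ → χ List.∈ Sub φ →
         χ List.∈ Sub (ν Z ∙ ψ))

    -- From the configurations visited so far, latest first, to Eve's next one.
    Strategy : Set
    Strategy = List Config → Config

    -- The configurations π 0, …, π n form an initial segment of a play in
    -- which Eve follows σ; the values of π beyond n are irrelevant.
    record Follows (σ : Strategy) (π : ℕ → Config) (n : ℕ) : Set where
      field
        starts : π 0 ≡ (H₀ ⊢ φ)
        moves  : ∀ {i} → i ℕ.< n → π i ⟶ π (suc i)
        obeys  : ∀ {i} → i ℕ.< n → EveChooses (π i) →
                 π (suc i) ≡ σ (applyDownFrom π (suc i))

    record Winning (σ : Strategy) : Set where
      field
        legal    : ∀ π n → Follows σ π n → EveChooses (π n) → CanMove (π n) →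
                   π n ⟶ σ (applyDownFrom π (suc n))
        finite   : ∀ π n → Follows σ π n → ¬ CanMove (π n) → EveWinsAt (π n)
        infinite : ∀ π → (∀ n → Follows σ π n) → EveWinsInfinite π

    EveHasWinningStrategy : Set
    EveHasWinningStrategy = ∃ Winning

{-# OPTIONS --safe #-}
module Submission where

-- Eve keeps the truth of the current subformula in an environment built along
-- the play.  On entering νZ.ψ she fixes a post-fixed point of ψ as the value of
-- Z; on entering μZ.ψ she fixes an approximant, which each later unfolding of Z
-- replaces by a strictly smaller one.  No ordinals are needed: approximants are
-- indexed by well-founded trees.  Nor is monotonicity: for any extensional F,
-- an element of all prefixed points lies in some stage, and an element of
-- νZ.ψ lies in some Q ⊆ ψ(Q), directly by expanding the definitions.
--
-- By induction on ψ, an infinite play from ψ is won by Eve or comes back to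
-- unfold a variable bound outside ψ.  For μZ.ψ the trees bound the number of
-- returns to Z; for νZ.ψ, if Z is unfolded for ever then Z is outermost.
-- Nothing is bound outside φ itself, so there Eve wins.

open import Axiom.ExcludedMiddle using (ExcludedMiddle)
open import Data.Bool.Base using (Bool; true; false; T; not)
open import Data.Bool.Properties using (T?)
open import Data.Empty using (⊥; ⊥-elim)
open import Data.List.Base using (List; []; _∷_; _++_; applyDownFrom)
open import Data.List.Membership.Propositional using () renaming (_∈_ to _∈ˡ_; _∉_ to _∉ˡ_)
open import Data.List.Membership.Propositional.Properties using (∈-++⁻)
open import Data.List.Relation.Binary.Disjoint.Propositional using (Disjoint)
open import Data.List.Relation.Binary.Subset.Propositional using () renaming (_⊆_ to _⊆ˡ_)
open import Data.List.Relation.Binary.Subset.Propositional.Properties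
  using (xs⊆xs++ys; xs⊆ys++xs)
import Data.List.Relation.Unary.All as All
import Data.List.Relation.Unary.All.Properties as All
open import Data.List.Relation.Unary.AllPairs using ([]; _∷_)
open import Data.List.Relation.Unary.Any using (here; there)
open import Data.List.Relation.Unary.Unique.Propositional using (Unique)
open import Data.Nat.Base as ℕ using (ℕ; zero; suc)
import Data.Nat.Properties as ℕ
open import Data.Parity.Base using (0ℙ; _⁻¹)
open import Data.Product.Base using (_×_; _,_; proj₁; proj₂; ∃; ∃-syntax)
open import Data.Sum.Base as Sum using (_⊎_; inj₁; inj₂; [_,_]′)
open import Data.Unit.Base using (⊤; tt)
open import Function.Base using (_∘_; id)
open import Level using (0ℓ)
open import Relation.Binary.PropositionalEquality
  using (_≡_; _≢_; _≗_; refl; sym; trans; cong; subst)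
open import Relation.Nullary.Decidable.Core using (yes; no; ⌊_⌋; toWitness; fromWitness)
open import Relation.Nullary.Negation.Core using (¬_; contradiction)
open import Defs

-- Binders, subformulas and scoping.

Unique-++⁻ : ∀ {A : Set} (xs : List A) {ys} → Unique (xs ++ ys) →
             Unique xs × Unique ys × Disjoint xs ys
Unique-++⁻ []       u       = [] , u , λ ()
Unique-++⁻ (x ∷ xs) (p ∷ u) with Unique-++⁻ xs u
... | uˣ , uʸ , xs#ys = All.++⁻ˡ xs p ∷ uˣ , uʸ , λ where
  (here refl , x∈ys) → All.lookup (All.++⁻ʳ xs p) x∈ys refl
  (there x∈xs , x∈ys) → xs#ys (x∈xs , x∈ys)

module _ {Var Σ : Set} where

  binding⇒bound : ∀ {Z : Var} {θ χ} (φ : Positive Var Σ) →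
                  Binding Z θ χ → χ ∈ˡ Sub φ → Z ∈ˡ bound φ
  binding⇒bound (var _)   () (here refl)
  binding⇒bound (¬̇var _)  () (here refl)
  binding⇒bound (¬̇var _)  () (there (here refl))
  binding⇒bound (_ ∧ _)   () (here refl)
  binding⇒bound (φ ∧ ψ)   b  (there χ∈) =
    [ xs⊆xs++ys _ _ ∘ binding⇒bound φ b , xs⊆ys++xs _ (bound φ) ∘ binding⇒bound ψ b ]′
      (∈-++⁻ (Sub φ) χ∈)
  binding⇒bound (_ ∨ _)   () (here refl)
  binding⇒bound (φ ∨ ψ)   b  (there χ∈) =
    [ xs⊆xs++ys _ _ ∘ binding⇒bound φ b , xs⊆ys++xs _ (bound φ) ∘ binding⇒bound ψ b ]′
      (∈-++⁻ (Sub φ) χ∈)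
  binding⇒bound (⟨ _ ⟩ _) () (here refl)
  binding⇒bound (⟨ _ ⟩ φ) b  (there χ∈)  = binding⇒bound φ b χ∈
  binding⇒bound ([ _ ] _) () (here refl)
  binding⇒bound ([ _ ] φ) b  (there χ∈)  = binding⇒bound φ b χ∈
  binding⇒bound (μ _ ∙ _) μ-binds (here refl) = here refl
  binding⇒bound (μ _ ∙ φ) b  (there χ∈)  = there (binding⇒bound φ b χ∈)
  binding⇒bound (ν _ ∙ _) ν-binds (here refl) = here refl
  binding⇒bound (ν _ ∙ φ) b  (there χ∈)  = there (binding⇒bound φ b χ∈)

  bound⇒binding : ∀ {Z : Var} (φ : Positive Var Σ) → Z ∈ˡ bound φ →
                  ∃[ θ ] ∃[ χ ] Binding Z θ χ × χ ∈ˡ Sub φ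
  bound⇒binding-++ : ∀ {Z : Var} (φ ψ : Positive Var Σ) → Z ∈ˡ bound φ ++ bound ψ →
                     ∃[ θ ] ∃[ χ ] Binding Z θ χ × χ ∈ˡ Sub φ ++ Sub ψ
  bound⇒binding-++ φ ψ Z∈ with ∈-++⁻ (bound φ) Z∈
  ... | inj₁ Z∈φ = let θ , χ , b , χ∈ = bound⇒binding φ Z∈φ in
                   θ , χ , b , xs⊆xs++ys _ _ χ∈
  ... | inj₂ Z∈ψ = let θ , χ , b , χ∈ = bound⇒binding ψ Z∈ψ in
                   θ , χ , b , xs⊆ys++xs _ (Sub φ) χ∈

  bound⇒binding (φ ∧ ψ)   Z∈          =
    let θ , χ , b , χ∈ = bound⇒binding-++ φ ψ Z∈ in θ , χ , b , there χ∈
  bound⇒binding (φ ∨ ψ)   Z∈          =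
    let θ , χ , b , χ∈ = bound⇒binding-++ φ ψ Z∈ in θ , χ , b , there χ∈
  bound⇒binding (⟨ _ ⟩ φ) Z∈          =
    let θ , χ , b , χ∈ = bound⇒binding φ Z∈ in θ , χ , b , there χ∈
  bound⇒binding ([ _ ] φ) Z∈          =
    let θ , χ , b , χ∈ = bound⇒binding φ Z∈ in θ , χ , b , there χ∈
  bound⇒binding (μ _ ∙ _) (here refl) = _ , _ , μ-binds , here refl
  bound⇒binding (μ _ ∙ φ) (there Z∈)  =
    let θ , χ , b , χ∈ = bound⇒binding φ Z∈ in θ , χ , b , there χ∈
  bound⇒binding (ν _ ∙ _) (here refl) = _ , _ , ν-binds , here refl
  bound⇒binding (ν _ ∙ φ) (there Z∈)  =
    let θ , χ , b , χ∈ = bound⇒binding φ Z∈ in θ , χ , b , there χ∈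

  SameBinder : Positive Var Σ → Set
  SameBinder φ = ∀ {Z θ θ′ χ χ′} → Binding Z θ χ → Binding Z θ′ χ′ →
                 χ ∈ˡ Sub φ → χ′ ∈ˡ Sub φ → (θ , χ) ≡ (θ′ , χ′)

  -- Two different binders of `Z` would sit on the two sides of a connective, or one at the root and
  -- one inside, and either way `Z` would be listed twice.
  sameBinder : ∀ φ → Unique (bound φ) → SameBinder φ
  sameBinder-++ : ∀ φ ψ → Unique (bound φ ++ bound ψ) →
                  ∀ {Z θ θ′ χ χ′} → Binding Z θ χ → Binding Z θ′ χ′ →
                  χ ∈ˡ Sub φ ++ Sub ψ → χ′ ∈ˡ Sub φ ++ Sub ψ → (θ , χ) ≡ (θ′ , χ′)
  sameBinder-++ φ ψ u b b′ χ∈ χ′∈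
    with Unique-++⁻ (bound φ) u | ∈-++⁻ (Sub φ) χ∈ | ∈-++⁻ (Sub φ) χ′∈
  ... | uφ , _ , _ | inj₁ ∈φ | inj₁ ∈φ′ = sameBinder φ uφ b b′ ∈φ ∈φ′
  ... | _ , uψ , _ | inj₂ ∈ψ | inj₂ ∈ψ′ = sameBinder ψ uψ b b′ ∈ψ ∈ψ′
  ... | _ , _ , φ#ψ | inj₁ ∈φ | inj₂ ∈ψ =
    ⊥-elim (φ#ψ (binding⇒bound φ b ∈φ , binding⇒bound ψ b′ ∈ψ))
  ... | _ , _ , φ#ψ | inj₂ ∈ψ | inj₁ ∈φ =
    ⊥-elim (φ#ψ (binding⇒bound φ b′ ∈φ , binding⇒bound ψ b ∈ψ))

  sameBinder (var _)   u () _ (here refl) _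
  sameBinder (¬̇var _)  u () _ (here refl) _
  sameBinder (¬̇var _)  u () _ (there (here refl)) _
  sameBinder (_ ∧ _)   u () _ (here refl) _
  sameBinder (_ ∧ _)   u _ () _ (here refl)
  sameBinder (φ ∧ ψ)   u b b′ (there χ∈) (there χ′∈) = sameBinder-++ φ ψ u b b′ χ∈ χ′∈
  sameBinder (_ ∨ _)   u () _ (here refl) _
  sameBinder (_ ∨ _)   u _ () _ (here refl)
  sameBinder (φ ∨ ψ)   u b b′ (there χ∈) (there χ′∈) = sameBinder-++ φ ψ u b b′ χ∈ χ′∈
  sameBinder (⟨ _ ⟩ _) u () _ (here refl) _
  sameBinder (⟨ _ ⟩ _) u _ () _ (here refl)
  sameBinder (⟨ _ ⟩ φ) u b b′ (there χ∈) (there χ′∈) = sameBinder φ u b b′ χ∈ χ′∈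
  sameBinder ([ _ ] _) u () _ (here refl) _
  sameBinder ([ _ ] _) u _ () _ (here refl)
  sameBinder ([ _ ] φ) u b b′ (there χ∈) (there χ′∈) = sameBinder φ u b b′ χ∈ χ′∈
  sameBinder (μ _ ∙ _) u μ-binds μ-binds (here refl) (here refl) = refl
  sameBinder (μ _ ∙ φ) (Z∉ ∷ _) μ-binds b′ (here refl) (there χ′∈) =
    ⊥-elim (All.lookup Z∉ (binding⇒bound φ b′ χ′∈) refl)
  sameBinder (μ _ ∙ φ) (Z∉ ∷ _) b μ-binds (there χ∈) (here refl) =
    ⊥-elim (All.lookup Z∉ (binding⇒bound φ b χ∈) refl)
  sameBinder (μ _ ∙ φ) (_ ∷ u) b b′ (there χ∈) (there χ′∈) = sameBinder φ u b b′ χ∈ χ′∈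
  sameBinder (ν _ ∙ _) u ν-binds ν-binds (here refl) (here refl) = refl
  sameBinder (ν _ ∙ φ) (Z∉ ∷ _) ν-binds b′ (here refl) (there χ′∈) =
    ⊥-elim (All.lookup Z∉ (binding⇒bound φ b′ χ′∈) refl)
  sameBinder (ν _ ∙ φ) (Z∉ ∷ _) b ν-binds (there χ∈) (here refl) =
    ⊥-elim (All.lookup Z∉ (binding⇒bound φ b χ∈) refl)
  sameBinder (ν _ ∙ φ) (_ ∷ u) b b′ (there χ∈) (there χ′∈) = sameBinder φ u b b′ χ∈ χ′∈

  -- d lists the variables bound by the context and B all those bound in the
  -- whole formula; a negated variable has to be free.
  Scoped : (B d : List Var) → Positive Var Σ → Set
  Scoped B d (var Z)   = Z ∈ˡ d ⊎ Z ∉ˡ B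
  Scoped B d (¬̇var Z)  = Z ∉ˡ B
  Scoped B d (φ ∧ ψ)   = Scoped B d φ × Scoped B d ψ
  Scoped B d (φ ∨ ψ)   = Scoped B d φ × Scoped B d ψ
  Scoped B d (⟨ _ ⟩ φ) = Scoped B d φ
  Scoped B d ([ _ ] φ) = Scoped B d φ
  Scoped B d (μ Z ∙ φ) = Scoped B (Z ∷ d) φ
  Scoped B d (ν Z ∙ φ) = Scoped B (Z ∷ d) φ

-- Stages of least fixed points.

-- Trees replace ordinals: instead of a union of earlier stages, each point x
-- gets its own earlier stage f x.
data Tree (A : Set) : Set where
  leaf : Tree A
  sup  : (A → Tree A) → Tree A

stage : ∀ {A : Set} → ((A → Bool) → (A → Bool)) → Tree A → (A → Bool)
stage F leaf    _ = false
stage F (sup f) x = F (stage F (f x)) x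

module _ (em : ExcludedMiddle 0ℓ) where
  open Classical em

  em⁻ : {P : Set} → T ⌊ em {P} ⌋ → P
  em⁻ = toWitness {a? = em}

  em⁺ : {P : Set} → P → T ⌊ em {P} ⌋
  em⁺ = fromWitness {a? = em}

  em-cong : {P Q : Set} → (P → Q) → (Q → P) → ⌊ em {P} ⌋ ≡ ⌊ em {Q} ⌋
  em-cong {P} {Q} f g with em {P} | em {Q}
  ... | yes _ | yes _ = refl
  ... | yes p | no ¬q = contradiction (f p) ¬q
  ... | no ¬p | yes q = contradiction (g q) ¬p
  ... | no _  | no _  = refl

  em-not : ∀ b → ⌊ em {¬ T b} ⌋ ≡ not b
  em-not true with em {¬ ⊤}
  ... | yes ¬t = contradiction tt ¬t
  ... | no _   = refl
  em-not false with em {¬ ⊥}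
  ... | yes _  = refl
  ... | no ¬¬f = contradiction id ¬¬f

  -- Let `Q` be the set of points that lie in `F` of some stage. Choosing one witnessing tree per
  -- point gives a single tree `sup f` whose stage is `Q` pointwise. So every point of `F Q` has
  -- `sup f` itself as a witness, which makes `Q` prefixed and puts `x` in it.
  lfp⇒stage : ∀ {A : Set} (F : 𝒫 A → 𝒫 A) → (∀ {P Q} → P ≗ Q → F P ≗ F Q) →
              ∀ {x} → (∀ Q → F Q ⊆ Q → x ∈ Q) → ∃[ t ] x ∈ stage F t
  lfp⇒stage {A} F F-cong {x} least = sup f , subst T (sym (stage≗ x)) (least Q prefixed)
    where
    InF : A → Set
    InF y = ∃[ t ] y ∈ F (stage F t)

    Q : 𝒫 A
    Q = ⁅ InF ⁆

    f : A → Tree A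
    f y with em {InF y}
    ... | yes (t , _) = t
    ... | no _        = leaf

    stage≗ : stage F (sup f) ≗ Q
    stage≗ y with em {InF y}
    -- Outside `Q` the choice `f` defaults to `leaf`; this adds no point to the stage, since
    -- otherwise `leaf` would be a witness for `y`.
    ... | no ∉Q with F (stage F leaf) y in eq
    ...   | true  = contradiction (leaf , subst T (sym eq) tt) ∉Q
    ...   | false = refl
    stage≗ y | yes (t , y∈) with F (stage F t) y
    ... | true = refl

    prefixed : F Q ⊆ Q
    prefixed {y} y∈FQ = em⁺ (sup f , subst T (sym (F-cong stage≗ y)) y∈FQ)

  -- Polarity of occurrences and scoping.

  module _ {Var Σ : Set} where

    -- The substitution puts one more negation above each free `X`, so the parity flips exactly when
    -- `X` is `Z`. Linking `p` and `q` by hypotheses lets the negation case invert both at once.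
    Occurs-⟪¬⟫⁻ : ∀ (φ : TFL Var Σ) {X Z p q} → (X ≡ Z → q ≡ p ⁻¹) → (X ≢ Z → q ≡ p) →
                  Occurs p Z (φ ⟪¬ X ⟫) → Occurs q Z φ
    Occurs-⟪¬⟫⁻ (var Y) {X} {Z} q₁ q₂ occ Y≡Z with em {Y ≡ X}
    ... | yes refl = trans (q₁ Y≡Z) (occ Y≡Z)
    ... | no Y≢X   = trans (q₂ λ { refl → Y≢X Y≡Z }) (occ Y≡Z)
    Occurs-⟪¬⟫⁻ (¬̇ φ) q₁ q₂ = Occurs-⟪¬⟫⁻ φ (cong _⁻¹ ∘ q₁) (cong _⁻¹ ∘ q₂)
    Occurs-⟪¬⟫⁻ (φ ∧ ψ) q₁ q₂ (o , o′) = Occurs-⟪¬⟫⁻ φ q₁ q₂ o , Occurs-⟪¬⟫⁻ ψ q₁ q₂ o′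
    Occurs-⟪¬⟫⁻ (⟨ _ ⟩ φ) q₁ q₂ = Occurs-⟪¬⟫⁻ φ q₁ q₂
    Occurs-⟪¬⟫⁻ (μ Y ∙ φ) {X} {Z} q₁ q₂ occ Y≢Z with em {Y ≡ X}
    ... | yes refl = subst (λ r → Occurs r Z φ) (sym (q₂ Y≢Z)) (occ Y≢Z)
    ... | no _     = Occurs-⟪¬⟫⁻ φ q₁ q₂ (occ Y≢Z)

    WellFormed-⟪¬⟫⁻ : ∀ (φ : TFL Var Σ) {X} → WellFormed (φ ⟪¬ X ⟫) → WellFormed φ
    WellFormed-⟪¬⟫⁻ (var _)   wf        = tt
    WellFormed-⟪¬⟫⁻ (¬̇ φ)     wf        = WellFormed-⟪¬⟫⁻ φ wf
    WellFormed-⟪¬⟫⁻ (φ ∧ ψ)   (wf , wf′) = WellFormed-⟪¬⟫⁻ φ wf , WellFormed-⟪¬⟫⁻ ψ wf′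
    WellFormed-⟪¬⟫⁻ (⟨ _ ⟩ φ) wf        = WellFormed-⟪¬⟫⁻ φ wf
    WellFormed-⟪¬⟫⁻ (μ Y ∙ φ) {X} wf with em {Y ≡ X}
    ... | yes refl = wf
    ... | no Y≢X   =
      Occurs-⟪¬⟫⁻ φ (λ X≡Y → contradiction (sym X≡Y) Y≢X) (λ _ → refl) (proj₁ wf) ,
      WellFormed-⟪¬⟫⁻ φ (proj₂ wf)

    -- Variables bound by the context occur only positively, which excludes them below a negation: a
    -- negated variable must then be unbound in the whole formula.
    scoped : ∀ {B d} (φ : Positive Var Σ) → WellFormed (expand φ) →
             (∀ {Z} → Free Z φ → Z ∈ˡ d ⊎ Z ∉ˡ B) →
             (∀ {Z} → Z ∈ˡ d → Occurs 0ℙ Z (expand φ)) → Scoped B d φ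
    scoped-binder : ∀ {B d Z} (φ : Positive Var Σ) →
                    Occurs 0ℙ Z (expand φ) → WellFormed (expand φ) →
                    (∀ {X} → X ≢ Z × Free X φ → X ∈ˡ d ⊎ X ∉ˡ B) →
                    (∀ {X} → X ∈ˡ d → Z ≢ X → Occurs 0ℙ X (expand φ)) →
                    Scoped B (Z ∷ d) φ
    scoped-binder {B} {d} {Z} φ occ wf fr pos = scoped φ wf fr′ pos′
      where
      fr′ : ∀ {X} → Free X φ → X ∈ˡ Z ∷ d ⊎ X ∉ˡ B
      fr′ {X} X-free with em {X ≡ Z}
      ... | yes refl = inj₁ (here refl)
      ... | no X≢Z   = Sum.map₁ there (fr (X≢Z , X-free))

      pos′ : ∀ {X} → X ∈ˡ Z ∷ d → Occurs 0ℙ X (expand φ)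
      pos′ (here refl) = occ
      pos′ {X} (there X∈d) with em {Z ≡ X}
      -- A shadowed outer variable takes its positivity from the new binder.
      ... | yes refl = occ
      ... | no Z≢X   = pos X∈d Z≢X

    scoped (var _)   wf fr pos = fr refl
    scoped (¬̇var _)  wf fr pos with fr refl
    ... | inj₁ Z∈d = contradiction (pos Z∈d refl) λ ()
    ... | inj₂ Z∉B = Z∉B
    scoped (φ ∧ ψ)   (wf , wf′) fr pos =
      scoped φ wf (fr ∘ inj₁) (proj₁ ∘ pos) , scoped ψ wf′ (fr ∘ inj₂) (proj₂ ∘ pos)
    scoped (φ ∨ ψ)   (wf , wf′) fr pos =
      scoped φ wf (fr ∘ inj₁) (proj₁ ∘ pos) , scoped ψ wf′ (fr ∘ inj₂) (proj₂ ∘ pos)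
    scoped (⟨ _ ⟩ φ) wf fr pos = scoped φ wf fr pos
    scoped ([ _ ] φ) wf fr pos = scoped φ wf fr pos
    scoped (μ Z ∙ φ) (occ , wf) fr pos = scoped-binder φ occ wf fr pos
    scoped (ν Z ∙ φ) (occ , wf) fr pos =
      scoped-binder φ
        -- The negation inside the expanded `ν` makes the parity at `Z` odd and the substitution
        -- flips it back. For the other variables the two outer negations cancel.
        (Occurs-⟪¬⟫⁻ (expand φ) (λ _ → refl) (contradiction refl) occ)
        (WellFormed-⟪¬⟫⁻ (expand φ) wf) fr
        (λ X∈d Z≢X → Occurs-⟪¬⟫⁻ (expand φ) (λ Z≡X → contradiction Z≡X Z≢X)
                       (λ _ → refl) (pos X∈d Z≢X))

  -- Semantics: extensionality, substitution, membership in fixed points.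

  module _ {Var Σ : Set} (𝔗 : TSI Σ) where
    open Processes 𝔗
    open Semantics Var 𝔗

    private variable
      ρ ρ′ : Var → 𝒫 𝔖
      H : 𝔖

    ≔-same : ∀ Z {Q} → (ρ [ Z := Q ]) Z ≡ Q
    ≔-same Z with em {Z ≡ Z}
    ... | yes _  = refl
    ... | no Z≢Z = contradiction refl Z≢Z

    ≔-cong : ∀ {Z P Q} → (∀ X → ρ X ≗ ρ′ X) → P ≗ Q →
             ∀ X → (ρ [ Z := P ]) X ≗ (ρ′ [ Z := Q ]) X
    ≔-cong {Z = Z} ρ≗ρ′ P≗Q X with em {X ≡ Z}
    ... | yes _ = P≗Q
    ... | no _  = ρ≗ρ′ X

    ≗⇒⊆ : ∀ {P Q : 𝒫 𝔖} → P ≗ Q → P ⊆ Q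
    ≗⇒⊆ P≗Q {x} = subst T (P≗Q x)

    ¬-cong : ∀ {P Q : 𝒫 𝔖} → P ≗ Q → ⁅ _∉ P ⁆ ≗ ⁅ _∉ Q ⁆
    ¬-cong P≗Q H = em-cong (_∘ ≗⇒⊆ (sym ∘ P≗Q)) (_∘ ≗⇒⊆ P≗Q)

    ∧-cong : ∀ {P P′ Q Q′ : 𝒫 𝔖} → P ≗ Q → P′ ≗ Q′ →
             ⁅ (λ H → H ∈ P × H ∈ P′) ⁆ ≗ ⁅ (λ H → H ∈ Q × H ∈ Q′) ⁆
    ∧-cong P≗Q P′≗Q′ H = em-cong
      (λ (p , p′) → ≗⇒⊆ P≗Q p , ≗⇒⊆ P′≗Q′ p′)
      (λ (q , q′) → ≗⇒⊆ (sym ∘ P≗Q) q , ≗⇒⊆ (sym ∘ P′≗Q′) q′)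

    ◇-cong : ∀ {m} {P Q : 𝒫 𝔖} → P ≗ Q →
             ⁅ (λ H → ∃[ H′ ] H —[ m ]→ H′ × H′ ∈ P) ⁆ ≗
             ⁅ (λ H → ∃[ H′ ] H —[ m ]→ H′ × H′ ∈ Q) ⁆
    ◇-cong P≗Q H = em-cong
      (λ (H′ , H→H′ , p) → H′ , H→H′ , ≗⇒⊆ P≗Q p)
      (λ (H′ , H→H′ , q) → H′ , H→H′ , ≗⇒⊆ (sym ∘ P≗Q) q)

    μ-cong : ∀ {F G : 𝒫 𝔖 → 𝒫 𝔖} → (∀ Q → F Q ≗ G Q) →
             ⁅ (λ H → ∀ Q → F Q ⊆ Q → H ∈ Q) ⁆ ≗ ⁅ (λ H → ∀ Q → G Q ⊆ Q → H ∈ Q) ⁆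
    μ-cong F≗G H = em-cong
      (λ h Q G⊆Q → h Q (G⊆Q ∘ ≗⇒⊆ (F≗G Q)))
      (λ h Q F⊆Q → h Q (F⊆Q ∘ ≗⇒⊆ (sym ∘ F≗G Q)))

    -- Supplies the extensionality that `lfp⇒stage` asks of the operator.
    ⟦⟧-cong : ∀ φ → (∀ X → ρ X ≗ ρ′ X) → ⟦ φ ⟧ ρ ≗ ⟦ φ ⟧ ρ′
    ⟦⟧-cong (var X)   ρ≗ρ′ = ρ≗ρ′ X
    ⟦⟧-cong (¬̇ φ)     ρ≗ρ′ = ¬-cong (⟦⟧-cong φ ρ≗ρ′)
    ⟦⟧-cong (φ ∧ ψ)   ρ≗ρ′ = ∧-cong (⟦⟧-cong φ ρ≗ρ′) (⟦⟧-cong ψ ρ≗ρ′)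
    ⟦⟧-cong (⟨ _ ⟩ φ) ρ≗ρ′ = ◇-cong (⟦⟧-cong φ ρ≗ρ′)
    ⟦⟧-cong (μ Z ∙ φ) ρ≗ρ′ = μ-cong λ Q → ⟦⟧-cong φ (≔-cong ρ≗ρ′ λ _ → refl)

    -- The substitution lemma, with both environments kept abstract so that it passes under binders:
    -- a binder of `Z` overwrites the disagreement at `Z`, and any other binder preserves the two
    -- hypotheses.
    ⟦⟪¬⟫⟧ : ∀ φ Z → (∀ H → ρ′ Z H ≡ not (ρ Z H)) → (∀ X → X ≢ Z → ρ X ≗ ρ′ X) →
            ⟦ φ ⟪¬ Z ⟫ ⟧ ρ ≗ ⟦ φ ⟧ ρ′
    ⟦⟪¬⟫⟧ {ρ = ρ} (var X) Z ρ′Z ρ≗ρ′ H with em {X ≡ Z}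
    ... | yes refl = trans (em-not (ρ X H)) (sym (ρ′Z H))
    ... | no X≢Z   = ρ≗ρ′ X X≢Z H
    ⟦⟪¬⟫⟧ (¬̇ φ)     Z ρ′Z ρ≗ρ′ = ¬-cong (⟦⟪¬⟫⟧ φ Z ρ′Z ρ≗ρ′)
    ⟦⟪¬⟫⟧ (φ ∧ ψ)   Z ρ′Z ρ≗ρ′ = ∧-cong (⟦⟪¬⟫⟧ φ Z ρ′Z ρ≗ρ′) (⟦⟪¬⟫⟧ ψ Z ρ′Z ρ≗ρ′)
    ⟦⟪¬⟫⟧ (⟨ _ ⟩ φ) Z ρ′Z ρ≗ρ′ = ◇-cong (⟦⟪¬⟫⟧ φ Z ρ′Z ρ≗ρ′)
    ⟦⟪¬⟫⟧ {ρ′ = ρ′} {ρ = ρ} (μ Y ∙ φ) Z ρ′Z ρ≗ρ′ with em {Y ≡ Z}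
    ... | yes refl = μ-cong λ Q → ⟦⟧-cong φ (upd Q)
      where
      upd : ∀ Q X → (ρ [ Y := Q ]) X ≗ (ρ′ [ Y := Q ]) X
      upd Q X with em {X ≡ Y}
      ... | yes _  = λ _ → refl
      ... | no X≢Y = ρ≗ρ′ X X≢Y
    ... | no Y≢Z = μ-cong λ Q → ⟦⟪¬⟫⟧ φ Z (updZ Q) (upd Q)
      where
      updZ : ∀ Q H → (ρ′ [ Y := Q ]) Z H ≡ not ((ρ [ Y := Q ]) Z H)
      updZ Q H with em {Z ≡ Y}
      ... | yes Z≡Y = contradiction (sym Z≡Y) Y≢Z
      ... | no _    = ρ′Z H
      upd : ∀ Q X → X ≢ Z → (ρ [ Y := Q ]) X ≗ (ρ′ [ Y := Q ]) X
      upd Q X X≢Z with em {X ≡ Y}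
      ... | yes _ = λ _ → refl
      ... | no _  = ρ≗ρ′ X X≢Z

    ∈-∨⁻ : ∀ (φ ψ : Positive Var Σ) → H ∈ ⟦ expand (φ ∨ ψ) ⟧ ρ →
           H ∈ ⟦ expand φ ⟧ ρ ⊎ H ∈ ⟦ expand ψ ⟧ ρ
    ∈-∨⁻ {H} {ρ} φ ψ h with T? (⟦ expand φ ⟧ ρ H) | T? (⟦ expand ψ ⟧ ρ H)
    ... | yes p | _     = inj₁ p
    ... | _     | yes q = inj₂ q
    ... | no ¬p | no ¬q = contradiction (em⁺ (em⁺ ¬p , em⁺ ¬q)) (em⁻ h)

    ∈-□⁻ : ∀ m (φ : Positive Var Σ) → H ∈ ⟦ expand ([ m ] φ) ⟧ ρ →
           ∀ {H′} → H —[ m ]→ H′ → H′ ∈ ⟦ expand φ ⟧ ρ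
    ∈-□⁻ {ρ = ρ} m φ h {H′} H→H′ with T? (⟦ expand φ ⟧ ρ H′)
    ... | yes p = p
    ... | no ¬p = contradiction (em⁺ (H′ , H→H′ , em⁺ ¬p)) (em⁻ h)

    body : (Var → 𝒫 𝔖) → Var → Positive Var Σ → 𝒫 𝔖 → 𝒫 𝔖
    body ρ Z φ Q = ⟦ expand φ ⟧ (ρ [ Z := Q ])

    ∈-μ⁻ : ∀ Z (φ : Positive Var Σ) → H ∈ ⟦ expand (μ Z ∙ φ) ⟧ ρ →
           ∃[ t ] H ∈ stage (body ρ Z φ) t
    ∈-μ⁻ {ρ = ρ} Z φ h =
      lfp⇒stage (body ρ Z φ) (λ P≗Q → ⟦⟧-cong (expand φ) (≔-cong (λ _ _ → refl) P≗Q)) (em⁻ h)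

    -- If no post-fixed point contained `H`, every prefixed point `Q` of the dual operator would
    -- contain it, as otherwise `not ∘ Q` would be such a post-fixed point. This contradicts the
    -- negated `μ` that `ν` abbreviates.
    ∈-ν⁻ : ∀ Z (φ : Positive Var Σ) → H ∈ ⟦ expand (ν Z ∙ φ) ⟧ ρ →
           ∃[ Q ] (∀ H′ → H′ ∈ Q → H′ ∈ body ρ Z φ Q) × H ∈ Q
    ∈-ν⁻ {H} {ρ} Z φ h with em {∃[ Q ] (∀ H′ → H′ ∈ Q → H′ ∈ body ρ Z φ Q) × H ∈ Q}
    ... | yes ∃Q = ∃Q
    ... | no ∄Q  = contradiction (em⁺ H∈all) (em⁻ h)
      where
      H∈all : ∀ Q → ⟦ ¬̇ (expand φ ⟪¬ Z ⟫) ⟧ (ρ [ Z := Q ]) ⊆ Q → H ∈ Q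
      H∈all Q pre with T? (Q H)
      ... | yes H∈Q = H∈Q
      ... | no H∉Q  = contradiction (not ∘ Q , post , T-not H∉Q) ∄Q
        where
        T-not : ∀ {b} → ¬ T b → T (not b)
        T-not {true}  ¬t = ¬t tt
        T-not {false} _  = tt

        not-T : ∀ {b} → T (not b) → ¬ T b
        not-T {true} ()

        negated : ∀ x → (ρ [ Z := not ∘ Q ]) Z x ≡ not ((ρ [ Z := Q ]) Z x)
        negated x rewrite ≔-same {ρ} Z {Q} | ≔-same {ρ} Z {not ∘ Q} = refl

        others : ∀ X → X ≢ Z → (ρ [ Z := Q ]) X ≗ (ρ [ Z := not ∘ Q ]) X
        others X X≢Z with em {X ≡ Z}
        ... | yes X≡Z = contradiction X≡Z X≢Z
        ... | no _    = λ _ → refl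

        post : ∀ x → x ∈ not ∘ Q → x ∈ body ρ Z φ (not ∘ Q)
        post x x∉Q with T? (⟦ expand φ ⟪¬ Z ⟫ ⟧ (ρ [ Z := Q ]) x)
        ... | yes p = ≗⇒⊆ (⟦⟪¬⟫⟧ (expand φ) Z negated others) p
        ... | no ¬p = contradiction (pre (em⁺ ¬p)) (not-T x∉Q)

  -- Positions annotated with approximants and post-fixed points.

  module _ {Var Σ : Set} (𝔐 : Model Var Σ) (φ : Positive Var Σ)
           (binders-distinct : Unique (bound φ)) where
    open Model 𝔐
    open Semantics Var 𝔗
    open Game 𝔐 initial φ

    -- For every binder entered, the approximant or post-fixed point that its
    -- variable currently stands for; unfolding a variable drops the binders
    -- entered since.
    data Ctx : Set where
      ∅       : Ctx
      lfp     : Ctx → Var → Positive Var Σ → Tree 𝔖 → Ctx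
      gfp     : Ctx → Var → Positive Var Σ → 𝒫 𝔖 → Ctx

    env : Ctx → Var → 𝒫 𝔖
    env ∅             = 𝒱
    env (lfp Γ Z ψ t) = env Γ [ Z := stage (body 𝔗 (env Γ) Z ψ) t ]
    env (gfp Γ Z ψ Q) = env Γ [ Z := Q ]

    dom : Ctx → List Var
    dom ∅             = []
    dom (lfp Γ Z _ _) = Z ∷ dom Γ
    dom (gfp Γ Z _ _) = Z ∷ dom Γ

    infix 2.5 _▸_
    record State : Set where
      constructor _▸_
      field
        ctx  : Ctx
        conf : Config
    open State

    private variable
      Γ : Ctx
      H : 𝔖
      Z : Var
      ψ : Positive Var Σ
      s : State
      C′ : Config
      k m n : ℕ
      d d′ : List Var

    -- Unfolds an entry for `Z` and discards the entries above it. A least fixed point continues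
    -- with the subtree `f H` at the current process, so a `leaf` cannot be resumed.
    data Resume : Ctx → Var → 𝔖 → State → Set where
      here-μ  : ∀ {f} → Resume (lfp Γ Z ψ (sup f)) Z H (lfp Γ Z ψ (f H) ▸ H ⊢ ψ)
      here-ν  : ∀ {Q} → Resume (gfp Γ Z ψ Q) Z H (gfp Γ Z ψ Q ▸ H ⊢ ψ)
      there-μ : ∀ {X θ t} → Resume Γ Z H s → Resume (lfp Γ X θ t) Z H s
      there-ν : ∀ {X θ Q} → Resume Γ Z H s → Resume (gfp Γ X θ Q) Z H s

    infix 2 _⇒_
    -- Only the bookkeeping of a move: processes, trees and sets are arbitrary. The analysis of
    -- infinite runs rests on this relation alone; truth is carried by `Valid`.
    data _⇒_ : State → State → Set where
      μ-enter : ∀ t → Γ ▸ H ⊢ μ Z ∙ ψ ⇒ lfp Γ Z ψ t ▸ H ⊢ var Z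
      ν-enter : ∀ Q → Γ ▸ H ⊢ ν Z ∙ ψ ⇒ gfp Γ Z ψ Q ▸ H ⊢ var Z
      resume  : Resume Γ Z H s → Γ ▸ H ⊢ var Z ⇒ s
      ∨-left  : ∀ {ψ₀ ψ₁} → Γ ▸ H ⊢ ψ₀ ∨ ψ₁ ⇒ Γ ▸ H ⊢ ψ₀
      ∨-right : ∀ {ψ₀ ψ₁} → Γ ▸ H ⊢ ψ₀ ∨ ψ₁ ⇒ Γ ▸ H ⊢ ψ₁
      ∧-left  : ∀ {ψ₀ ψ₁} → Γ ▸ H ⊢ ψ₀ ∧ ψ₁ ⇒ Γ ▸ H ⊢ ψ₀
      ∧-right : ∀ {ψ₀ ψ₁} → Γ ▸ H ⊢ ψ₀ ∧ ψ₁ ⇒ Γ ▸ H ⊢ ψ₁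
      ◇-step  : ∀ {H′ m} → Γ ▸ H ⊢ ⟨ m ⟩ ψ ⇒ Γ ▸ H′ ⊢ ψ
      □-step  : ∀ {H′ m} → Γ ▸ H ⊢ [ m ] ψ ⇒ Γ ▸ H′ ⊢ ψ

    -- Weaker than membership in `Sub φ`: it also holds at the `var Z` reached on entering a binder
    -- whose body does not mention `Z`.
    BindersInφ : Positive Var Σ → Set
    BindersInφ ψ = ∀ Z θ χ → Binding Z θ χ → χ ∈ˡ Sub ψ → χ ∈ˡ Sub φ

    narrow : ∀ χ → Sub ψ ⊆ˡ Sub χ → BindersInφ χ → BindersInφ ψ
    narrow _ ψ⊆χ in-φ Z θ θ′ b = in-φ Z θ θ′ b ∘ ψ⊆χ

    var-binders : BindersInφ (var Z)
    var-binders _ _ _ () (here refl)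

    Sound : Ctx → Set
    Sound ∅             = ⊤
    Sound (lfp Γ Z ψ _) =
      Sound Γ × Scoped (bound φ) (Z ∷ dom Γ) ψ × BindersInφ (μ Z ∙ ψ)
    Sound (gfp Γ Z ψ Q) =
      Sound Γ × Scoped (bound φ) (Z ∷ dom Γ) ψ × BindersInφ (ν Z ∙ ψ) ×
      (∀ H → H ∈ Q → H ∈ body 𝔗 (env Γ) Z ψ Q)

    Valid : State → Set
    Valid (Γ ▸ H ⊢ ψ) =
      Sound Γ × Scoped (bound φ) (dom Γ) ψ × BindersInφ ψ × H ∈ ⟦ expand ψ ⟧ (env Γ)

    dom⊆bound : ∀ Γ → Sound Γ → dom Γ ⊆ˡ bound φ
    dom⊆bound (lfp Γ Z ψ t) (_ , _ , bs) (here refl) =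
      binding⇒bound φ μ-binds (bs _ _ _ μ-binds (here refl))
    dom⊆bound (lfp Γ Z ψ t) (snd , _) (there Z∈) = dom⊆bound Γ snd Z∈
    dom⊆bound (gfp Γ Z ψ t) (_ , _ , bs , _) (here refl) =
      binding⇒bound φ ν-binds (bs _ _ _ ν-binds (here refl))
    dom⊆bound (gfp Γ Z ψ t) (snd , _) (there Z∈) = dom⊆bound Γ snd Z∈

    Resumable : Ctx → Var → 𝔖 → Set
    Resumable Γ Z H = ∃[ Γ′ ] ∃[ θ ] ∃[ χ ] Resume Γ Z H (Γ′ ▸ H ⊢ θ) ×
                      Valid (Γ′ ▸ H ⊢ θ) × Binding Z θ χ × χ ∈ˡ Sub φ

    lookup : ∀ Γ → Sound Γ → H ∈ env Γ Z → Resumable Γ Z H ⊎ (Z ∉ˡ dom Γ × H ∈ 𝒱 Z)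
    lookup ∅ _ h = inj₂ ((λ ()) , h)
    lookup {Z = Z} (lfp Γ X θ t) (snd , sc , bs) h with em {Z ≡ X} | t
    -- Membership in the stage of `sup f` computes to truth of the body with the stage of `f H` for
    -- `Z`, so `h` serves as it is. A `leaf` cannot occur, as its stage is empty.
    ... | yes refl | sup f =
      inj₁ (_ , _ , _ , here-μ , ((snd , sc , bs) , sc , narrow (μ X ∙ θ) there bs , h) ,
            μ-binds , bs _ _ _ μ-binds (here refl))
    ... | no Z≢X   | _ with lookup Γ snd h
    ...   | inj₁ (_ , _ , _ , r , rest) = inj₁ (_ , _ , _ , there-μ r , rest)
    ...   | inj₂ (Z∉ , h′) =
      inj₂ ((λ { (here Z≡X) → Z≢X Z≡X ; (there Z∈) → Z∉ Z∈ }) , h′)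
    lookup {Z = Z} (gfp Γ X θ Q) (snd , sc , bs , post) h with em {Z ≡ X}
    ... | yes refl =
      inj₁ (_ , _ , _ , here-ν ,
            ((snd , sc , bs , post) , sc , narrow (ν X ∙ θ) there bs , post _ h) ,
            ν-binds , bs _ _ _ ν-binds (here refl))
    ... | no Z≢X with lookup Γ snd h
    ...   | inj₁ (_ , _ , _ , r , rest) = inj₁ (_ , _ , _ , there-ν r , rest)
    ...   | inj₂ (Z∉ , h′) =
      inj₂ ((λ { (here Z≡X) → Z≢X Z≡X ; (there Z∈) → Z∉ Z∈ }) , h′)

    Step : State → State → Set
    Step s s′ = (s ⇒ s′) × Valid s′ × (conf s ⟶ conf s′)

    eve-moves : ∀ s → Valid s → EveChooses (conf s) → ∃[ s′ ] Step s s′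
    eve-moves (Γ ▸ H ⊢ ψ ∨ χ) (snd , (sc₀ , sc₁) , bs , h) at-∨ with ∈-∨⁻ 𝔗 ψ χ h
    ... | inj₁ h₀ =
      _ , ∨-left , (snd , sc₀ , narrow (ψ ∨ χ) (there ∘ xs⊆xs++ys _ _) bs , h₀) , ∨-left
    ... | inj₂ h₁ =
      _ , ∨-right , (snd , sc₁ , narrow (ψ ∨ χ) (there ∘ xs⊆ys++xs _ (Sub ψ)) bs , h₁) ,
      ∨-right
    eve-moves (Γ ▸ H ⊢ ⟨ m ⟩ ψ) (snd , sc , bs , h) at-◇ =
      let H′ , H→H′ , h′ = em⁻ h in
      (Γ ▸ H′ ⊢ ψ) , ◇-step , (snd , sc , narrow (⟨ m ⟩ ψ) there bs , h′) , ◇-step H→H′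

    -- Truth passes to all successors of a conjunction or a box, so any choice of Adam lifts. At a
    -- disjunction or a diamond an arbitrary move may lose the truth; those positions are only
    -- reported and left to `eve-moves`.
    lift-move : ∀ s → Valid s → conf s ⟶ C′ →
                EveChooses (conf s) ⊎ ∃[ s′ ] Step s s′ × conf s′ ≡ C′
    lift-move (Γ ▸ H ⊢ μ Z ∙ ψ) (snd , sc , bs , h) μ-step =
      let t , h′ = ∈-μ⁻ 𝔗 Z ψ h in
      inj₂ (_ , (μ-enter t ,
                 ((snd , sc , bs) , inj₁ (here refl) , var-binders ,
                  subst (H ∈_) (sym (≔-same 𝔗 {env Γ} Z)) h′) ,
                 μ-step) , refl)
    lift-move (Γ ▸ H ⊢ ν Z ∙ ψ) (snd , sc , bs , h) ν-step =
      let Q , post , h′ = ∈-ν⁻ 𝔗 Z ψ h in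
      inj₂ (_ , (ν-enter Q ,
                 ((snd , sc , bs , post) , inj₁ (here refl) , var-binders ,
                  subst (H ∈_) (sym (≔-same 𝔗 {env Γ} Z)) h′) ,
                 ν-step) , refl)
    lift-move (Γ ▸ H ⊢ var Z) (snd , sc , bs , h) (unfold b χ∈) with lookup Γ snd h | sc
    ... | inj₂ (Z∉Γ , _) | inj₁ Z∈Γ = contradiction Z∈Γ Z∉Γ
    ... | inj₂ _ | inj₂ Z∉φ = contradiction (binding⇒bound φ b χ∈) Z∉φ
    -- The move names some binder of `Z` in `φ`; uniqueness identifies it with the one stored in the
    -- context.
    ... | inj₁ (_ , _ , _ , r , v , b′ , χ′∈) | _
      with sameBinder φ binders-distinct b b′ χ∈ χ′∈
    ...   | refl = inj₂ (_ , (resume r , v , unfold b χ∈) , refl)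
    lift-move (Γ ▸ H ⊢ ψ ∧ χ) (snd , (sc₀ , sc₁) , bs , h) ∧-left =
      inj₂ (_ , (∧-left ,
                 (snd , sc₀ , narrow (ψ ∧ χ) (there ∘ xs⊆xs++ys _ _) bs , proj₁ (em⁻ h)) ,
                 ∧-left) , refl)
    lift-move (Γ ▸ H ⊢ ψ ∧ χ) (snd , (sc₀ , sc₁) , bs , h) ∧-right =
      inj₂ (_ , (∧-right ,
                 (snd , sc₁ , narrow (ψ ∧ χ) (there ∘ xs⊆ys++xs _ (Sub ψ)) bs ,
                  proj₂ (em⁻ h)) ,
                 ∧-right) , refl)
    lift-move _ v ∨-left = inj₁ at-∨
    lift-move _ v ∨-right = inj₁ at-∨
    lift-move _ v (◇-step _) = inj₁ at-◇
    lift-move (Γ ▸ H ⊢ [ m ] ψ) (snd , sc , bs , h) (□-step H→H′) =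
      inj₂ (_ , (□-step ,
                 (snd , sc , narrow ([ m ] ψ) there bs , ∈-□⁻ 𝔗 m ψ h H→H′) ,
                 □-step H→H′) , refl)

    stuck⇒wins : ∀ s → Valid s → ¬ CanMove (conf s) → EveWinsAt (conf s)
    stuck⇒wins (Γ ▸ H ⊢ var Z) (snd , _ , _ , h) stuck with lookup Γ snd h
    ... | inj₁ (_ , _ , _ , _ , _ , b , χ∈) = contradiction (_ , unfold b χ∈) stuck
    ... | inj₂ (_ , h′) = at-var h′
    stuck⇒wins (Γ ▸ H ⊢ ¬̇var Z) (snd , Z∉φ , _ , h) _ =
      -- Contexts bind only variables bound in `φ`, so at a negated variable the environment is
      -- still `𝒱`.
      at-¬var (subst (λ Q → H ∉ Q) (env≡𝒱 Γ (Z∉φ ∘ dom⊆bound Γ snd)) (em⁻ h))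
      where
      env≡𝒱 : ∀ Γ → Z ∉ˡ dom Γ → env Γ Z ≡ 𝒱 Z
      env≡𝒱 ∅ _ = refl
      env≡𝒱 (lfp Γ X _ _) Z∉ with em {Z ≡ X}
      ... | yes refl = contradiction (here refl) Z∉
      ... | no _     = env≡𝒱 Γ (Z∉ ∘ there)
      env≡𝒱 (gfp Γ X _ _) Z∉ with em {Z ≡ X}
      ... | yes refl = contradiction (here refl) Z∉
      ... | no _     = env≡𝒱 Γ (Z∉ ∘ there)
    stuck⇒wins (Γ ▸ H ⊢ ψ ∧ χ)   v stuck = contradiction (_ , ∧-left) stuck
    stuck⇒wins (Γ ▸ H ⊢ ψ ∨ χ)   v stuck = contradiction (_ , ∨-left) stuck
    stuck⇒wins (Γ ▸ H ⊢ ⟨ m ⟩ ψ) v stuck =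
      contradiction (_ , proj₂ (proj₂ (proj₂ (eve-moves _ v at-◇)))) stuck
    stuck⇒wins (Γ ▸ H ⊢ [ m ] ψ) v stuck = at-□
    stuck⇒wins (Γ ▸ H ⊢ μ Z ∙ ψ) v stuck = contradiction (_ , μ-step) stuck
    stuck⇒wins (Γ ▸ H ⊢ ν Z ∙ ψ) v stuck = contradiction (_ , ν-step) stuck

    -- Infinite runs of annotated positions.

    module _ (run : ℕ → State) (runs : ∀ n → run n ⇒ run (suc n)) where

      -- The interval is half-open because the variable unfolded at an exit `m` belongs to the
      -- context and may lie outside `d`.
      record Within (d : List Var) (n m : ℕ) : Set where
        constructor within
        field
          unfolded : ∀ {k H Z} → n ℕ.≤ k → k ℕ.< m → conf (run k) ≡ (H ⊢ var Z) → Z ∈ˡ d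
      open Within

      -- Here `Γ` is the context on entering the subformula, so the resumed entry is older than the
      -- subformula. Naming the target `s` apart from `run (suc m)` allows matching on the
      -- resumption.
      Exit : Ctx → List Var → ℕ → ℕ → Set
      Exit Γ d n m = n ℕ.≤ m × Within d n m ×
        ∃[ H ] ∃[ Z ] conf (run m) ≡ (H ⊢ var Z) ×
        ∃[ s ] Resume Γ Z H s × run (suc m) ≡ s

      EveWins : Set
      EveWins = EveWinsInfinite (conf ∘ run)

      Outcome : Ctx → List Var → ℕ → Set
      Outcome Γ d n = EveWins ⊎ ∃ (Exit Γ d n)

      next : run n ≡ s → ∃[ s′ ] (s ⇒ s′) × run (suc n) ≡ s′
      next {n} refl = _ , runs n , refl

      within-⊆ : d ⊆ˡ d′ → Within d n m → Within d′ n m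
      within-⊆ d⊆d′ w .unfolded n≤k k<m at = d⊆d′ (unfolded w n≤k k<m at)

      within-empty : Within d n n
      within-empty .unfolded n≤k k<n _ = contradiction n≤k (ℕ.<⇒≱ k<n)

      within-one : (∀ {H Z} → conf (run n) ≡ (H ⊢ var Z) → Z ∈ˡ d) → Within d n (suc n)
      within-one here∈ .unfolded n≤k k<1+n at with ℕ.≤-antisym n≤k (ℕ.s≤s⁻¹ k<1+n)
      ... | refl = here∈ at

      within-trans : Within d n m → Within d m k → Within d n k
      within-trans {m = m} w w′ .unfolded {j} n≤j j<k at with j ℕ.<? m
      ... | yes j<m = unfolded w n≤j j<m at
      ... | no j≮m  = unfolded w′ (ℕ.≮⇒≥ j≮m) j<k at

      at-var∈ : conf (run n) ≡ (H ⊢ var Z) → Z ∈ˡ d →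
                ∀ {H Z} → conf (run n) ≡ (H ⊢ var Z) → Z ∈ˡ d
      at-var∈ at Z∈ at′ with trans (sym at) at′
      ... | refl = Z∈

      outcome-from : n ℕ.≤ m → d′ ⊆ˡ d → Within d n m → Outcome Γ d′ m → Outcome Γ d n
      outcome-from n≤m d′⊆d w (inj₁ wins) = inj₁ wins
      outcome-from n≤m d′⊆d w (inj₂ (k , m≤k , w′ , ex)) =
        inj₂ (k , ℕ.≤-trans n≤m m≤k , within-trans w (within-⊆ d′⊆d w′) , ex)

      not-var : (∀ {H Z} → C′ ≢ (H ⊢ var Z)) → conf (run n) ≡ C′ →
                ∀ {H Z} → conf (run n) ≡ (H ⊢ var Z) → Z ∈ˡ d
      not-var ≢var eq at = contradiction (trans (sym eq) at) ≢var

      later : (∀ {H Z} → C′ ≢ (H ⊢ var Z)) → conf (run n) ≡ C′ → d′ ⊆ˡ d →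
              Outcome Γ d′ (suc n) → Outcome Γ d n
      later {n = n} ≢var eq d′⊆d = outcome-from (ℕ.n≤1+n n) d′⊆d (within-one (not-var ≢var eq))

      at-variable : run n ≡ (Γ ▸ H ⊢ var Z) → Outcome Γ [] n
      at-variable eq with next eq
      ... | s , resume r , eq′ =
        inj₂ (_ , ℕ.≤-refl , within-empty ,
              _ , _ , cong conf eq , s , r , eq′)

      -- Structural recursion on the tree: a return to `Z` passes to a subtree and runs the body
      -- again, and a resumption further out is an exit from the `μ`.
      lfp-loop : ∀ {d n} → Z ∈ˡ d → bound ψ ⊆ˡ d →
                 (∀ {t H n} → run n ≡ (lfp Γ Z ψ t ▸ H ⊢ ψ) →
                              Outcome (lfp Γ Z ψ t) (bound ψ) n) →
                 ∀ t → Outcome (lfp Γ Z ψ t) d n → Outcome Γ d n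
      lfp-loop Z∈ ψ⊆ again t (inj₁ wins) = inj₁ wins
      lfp-loop Z∈ ψ⊆ again t (inj₂ (m , n≤m , w , H , X , at , s , there-μ r , eq)) =
        inj₂ (m , n≤m , w , H , X , at , s , r , eq)
      lfp-loop Z∈ ψ⊆ again (sup f) (inj₂ (m , n≤m , w , H , _ , at , _ , here-μ , eq)) =
        lfp-loop Z∈ ψ⊆ again (f H)
          -- The body restarts at `suc m`; position `m` itself shows `Z`, which `Z∈` accounts for.
          (outcome-from (ℕ.m≤n⇒m≤1+n n≤m) ψ⊆
            (within-trans w (within-one (at-var∈ at Z∈))) (again eq))

      -- Suppose there is no outcome. Then each pass through the body neither wins nor exits, so it
      -- comes back to `Z`; hence `Z` is visited beyond every bound, and Eve wins after all.
      gfp-loop : ∀ {Q n} → BindersInφ (ν Z ∙ ψ) →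
                 (∀ {H n} → run n ≡ (gfp Γ Z ψ Q ▸ H ⊢ ψ) →
                            Outcome (gfp Γ Z ψ Q) (bound ψ) n) →
                 Outcome (gfp Γ Z ψ Q) (Z ∷ bound ψ) n → Outcome Γ (Z ∷ bound ψ) n
      gfp-loop {Z} {ψ} {Γ} {Q} {n₀} bs again start with em {Outcome Γ (Z ∷ bound ψ) n₀}
      ... | yes o = o
      ... | no ¬o = inj₁ (Z , ψ , bs _ _ _ ν-binds (here refl) , often , outermost)
        where
        Visit : ℕ → Set
        Visit m = n₀ ℕ.≤ m × Within (Z ∷ bound ψ) n₀ (suc m) ×
                  ∃[ H ] conf (run m) ≡ (H ⊢ var Z) × run (suc m) ≡ (gfp Γ Z ψ Q ▸ H ⊢ ψ)

        visit : ∀ {n} → n₀ ℕ.≤ n → Within (Z ∷ bound ψ) n₀ n →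
                Outcome (gfp Γ Z ψ Q) (Z ∷ bound ψ) n → ∃[ m ] n ℕ.≤ m × Visit m
        visit n₀≤n w (inj₁ wins) = contradiction (inj₁ wins) ¬o
        visit n₀≤n w (inj₂ (m , n≤m , w′ , H , X , at , s , there-ν r , eq)) =
          contradiction (inj₂ (m , ℕ.≤-trans n₀≤n n≤m , within-trans w w′ ,
                               H , X , at , s , r , eq)) ¬o
        visit n₀≤n w (inj₂ (m , n≤m , w′ , H , _ , at , _ , here-ν , eq)) =
          m , n≤m , ℕ.≤-trans n₀≤n n≤m ,
          within-trans (within-trans w w′) (within-one (at-var∈ at (here refl))) , H , at , eq

        visits : ∀ n → ∃[ m ] n ℕ.≤ m × Visit m
        visits zero    = let m , _ , v = visit ℕ.≤-refl
                                 within-empty start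
                         in m , ℕ.z≤n , v
        visits (suc n) =
          let m , n≤m , n₀≤m , w , H , at , eq = visits n
              m′ , m<m′ , v = visit (ℕ.m≤n⇒m≤1+n n₀≤m) w
                (outcome-from ℕ.≤-refl there
                  within-empty (again eq))
          in m′ , ℕ.≤-trans (ℕ.s≤s n≤m) m<m′ , v

        often : InfinitelyOften (conf ∘ run) Z
        often n = let m , n≤m , _ , _ , H , at , _ = visits n in m , n≤m , H , at

        outermost : ∀ {Y θ χ} → InfinitelyOften (conf ∘ run) Y → Binding Y θ χ →
                    χ ∈ˡ Sub φ → χ ∈ˡ Sub (ν Z ∙ ψ)
        outermost {Y} io b χ∈ =
          -- Take an occurrence of `Y` at some `k` past the start. A visit at some `m` not before
          -- `k` confines all variables from the start up to `m` to `Z ∷ bound ψ`, so `Y` has a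
          -- binder inside the `ν`, and its binder in `φ` is unique.
          let k , n₀≤k , H , at = io n₀
              m , k≤m , _ , w , _ = visits k
              θ′ , χ′ , b′ , χ′∈ = bound⇒binding (ν Z ∙ ψ) (unfolded w n₀≤k (ℕ.s≤s k≤m) at)
          in subst (_∈ˡ Sub (ν Z ∙ ψ))
               (cong proj₂ (sameBinder φ binders-distinct b′ b (bs _ _ _ b′ χ′∈) χ∈)) χ′∈

      outcome : ∀ ψ → BindersInφ ψ → run n ≡ (Γ ▸ H ⊢ ψ) → Outcome Γ (bound ψ) n
      outcome (var Z)   bs eq = at-variable eq
      outcome (¬̇var Z)  bs eq with next eq
      ... | _ , () , _
      outcome (ψ ∧ χ)   bs eq with next eq
      ... | _ , ∧-left , eq′ =
        later (λ ()) (cong conf eq) (xs⊆xs++ys _ _)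
          (outcome ψ (narrow (ψ ∧ χ) (there ∘ xs⊆xs++ys _ _) bs) eq′)
      ... | _ , ∧-right , eq′ =
        later (λ ()) (cong conf eq) (xs⊆ys++xs _ (bound ψ))
          (outcome χ (narrow (ψ ∧ χ) (there ∘ xs⊆ys++xs _ (Sub ψ)) bs) eq′)
      outcome (ψ ∨ χ)   bs eq with next eq
      ... | _ , ∨-left , eq′ =
        later (λ ()) (cong conf eq) (xs⊆xs++ys _ _)
          (outcome ψ (narrow (ψ ∨ χ) (there ∘ xs⊆xs++ys _ _) bs) eq′)
      ... | _ , ∨-right , eq′ =
        later (λ ()) (cong conf eq) (xs⊆ys++xs _ (bound ψ))
          (outcome χ (narrow (ψ ∨ χ) (there ∘ xs⊆ys++xs _ (Sub ψ)) bs) eq′)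
      outcome (⟨ m ⟩ ψ) bs eq with next eq
      ... | _ , ◇-step , eq′ =
        later (λ ()) (cong conf eq) id (outcome ψ (narrow (⟨ m ⟩ ψ) there bs) eq′)
      outcome ([ m ] ψ) bs eq with next eq
      ... | _ , □-step , eq′ =
        later (λ ()) (cong conf eq) id (outcome ψ (narrow ([ m ] ψ) there bs) eq′)
      outcome (μ Z ∙ ψ) bs eq with next eq
      ... | _ , μ-enter t , eq′ =
        later (λ ()) (cong conf eq) id
          -- Entering the binder leads to `var Z` in the extended context, and unfolding it there is
          -- the first return that the loop treats.
          (lfp-loop (here refl) there (outcome ψ (narrow (μ Z ∙ ψ) there bs)) t
            (outcome-from ℕ.≤-refl (λ ())
              within-empty (at-variable eq′)))
      outcome (ν Z ∙ ψ) bs eq with next eq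
      ... | _ , ν-enter Q , eq′ =
        later (λ ()) (cong conf eq) id
          (gfp-loop bs (outcome ψ (narrow (ν Z ∙ ψ) there bs))
            (outcome-from ℕ.≤-refl (λ ())
              within-empty (at-variable eq′)))

      run-wins : run 0 ≡ (∅ ▸ initial ⊢ φ) → EveWins
      run-wins eq with outcome φ (λ _ _ _ _ → id) eq
      ... | inj₁ wins = wins
      ... | inj₂ (_ , _ , _ , _ , _ , _ , _ , () , _)

    -- Eve's strategy, with annotations recomputed from the history.

    EveWinsInfinite-cong : ∀ {π π′} → π ≗ π′ → EveWinsInfinite π → EveWinsInfinite π′
    EveWinsInfinite-cong {π} {π′} π≗π′ (Z , ψ , ν∈ , often , outermost) =
      Z , ψ , ν∈ , transport π≗π′ often , outermost ∘ transport (sym ∘ π≗π′)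
      where
      transport : ∀ {π π′ Y} → π ≗ π′ → InfinitelyOften π Y → InfinitelyOften π′ Y
      transport π≗π′ io n =
        let k , n≤k , H , at = io n in k , n≤k , H , trans (sym (π≗π′ k)) at

    start : State
    start = ∅ ▸ initial ⊢ φ

    -- The default `s` is reached only on histories that do not follow Eve's strategy.
    advance : State → Config → State
    advance s C with em {∃[ s′ ] Step s s′ × conf s′ ≡ C}
    ... | yes (s′ , _) = s′
    ... | no _         = s

    advance-step : ∀ {s C} → ∃[ s′ ] Step s s′ × conf s′ ≡ C →
                   Step s (advance s C) × conf (advance s C) ≡ C
    advance-step {s} {C} ∃s′ with em {∃[ s′ ] Step s s′ × conf s′ ≡ C}
    ... | yes (_ , step) = step
    ... | no ∄s′         = contradiction ∃s′ ∄s′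

    -- The history is stored latest first, so the recursion replays it from its oldest
    -- configuration, which is taken to be the initial one.
    state : List Config → State
    state []              = start
    state (_ ∷ [])        = start
    state (C ∷ h@(_ ∷ _)) = advance (state h) C

    choose : State → Config
    choose s with em {∃ (Step s)}
    ... | yes (s′ , _) = conf s′
    ... | no _         = conf s

    choose-step : ∃ (Step s) → ∃[ s′ ] Step s s′ × conf s′ ≡ choose s
    choose-step {s} ∃s′ with em {∃ (Step s)}
    ... | yes (s′ , step) = s′ , step , refl
    ... | no ∄s′          = contradiction ∃s′ ∄s′

    strategy : Strategy
    strategy = choose ∘ state

    module _ (initially : Valid start) where

      stateAt : (ℕ → Config) → ℕ → State
      stateAt π n = state (applyDownFrom π (suc n))

      Tracks : (ℕ → Config) → ℕ → Set
      Tracks π n = Valid (stateAt π n) × conf (stateAt π n) ≡ π n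

      track-step : ∀ π n → Follows strategy π (suc n) → Tracks π n →
                   Step (stateAt π n) (stateAt π (suc n)) ×
                   conf (stateAt π (suc n)) ≡ π (suc n)
      track-step π n follows (valid , conf≡)
        with lift-move _ valid (subst (_⟶ π (suc n)) (sym conf≡) (Follows.moves follows ℕ.≤-refl))
      ... | inj₂ lifted = advance-step lifted
      -- `advance` may pick another state than `choose` did; it is enough that some valid successor
      -- lies over the configuration that Eve moved to.
      ... | inj₁ chooses =
        let s′ , step , eq = choose-step (eve-moves _ valid chooses) in
        advance-step (s′ , step ,
          trans eq (sym (Follows.obeys follows ℕ.≤-refl (subst EveChooses conf≡ chooses))))

      follows-pred : ∀ {σ π n} → Follows σ π (suc n) → Follows σ π n
      follows-pred follows = record
        { starts = starts
        ; moves  = moves ∘ ℕ.m<n⇒m<1+n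
        ; obeys  = obeys ∘ ℕ.m<n⇒m<1+n
        } where open Follows follows

      track : ∀ π n → Follows strategy π n → Tracks π n
      track π zero    follows = initially , sym (Follows.starts follows)
      track π (suc n) follows =
        let (_ , valid , _) , conf≡ = track-step π n follows (track π n (follows-pred follows))
        in valid , conf≡

      strategy-wins : Winning strategy
      strategy-wins = record { legal = legal ; finite = finite ; infinite = infinite }
        where
        legal : ∀ π n → Follows strategy π n → EveChooses (π n) → CanMove (π n) →
                π n ⟶ strategy (applyDownFrom π (suc n))
        legal π n follows chooses _ =
          let valid , conf≡ = track π n follows
              s′ , (_ , _ , move) , eq =
                choose-step (eve-moves _ valid (subst EveChooses (sym conf≡) chooses))
          in subst (_⟶ choose (stateAt π n)) conf≡ (subst (_ ⟶_) eq move)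

        finite : ∀ π n → Follows strategy π n → ¬ CanMove (π n) → EveWinsAt (π n)
        finite π n follows stuck =
          let valid , conf≡ = track π n follows in
          subst EveWinsAt conf≡ (stuck⇒wins _ valid (stuck ∘ subst CanMove conf≡))

        infinite : ∀ π → (∀ n → Follows strategy π n) → EveWinsInfinite π
        infinite π follows =
          EveWinsInfinite-cong (λ n → proj₂ (track π n (follows n)))
            (run-wins (stateAt π)
              (λ n → proj₁ (proj₁ (track-step π n (follows (suc n)) (track π n (follows n)))))
              refl)

theorem7 : (em : ExcludedMiddle 0ℓ) → let open Classical em in
    {Var Σ : Set} (𝔐 : Model Var Σ) → let open Model 𝔐 in
    (φ : Positive Var Σ) → PositiveNormalForm φ →
    initial ∈ Semantics.⟦_⟧ Var 𝔗 (expand φ) 𝒱 →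
    Game.EveHasWinningStrategy 𝔐 initial φ
theorem7 em 𝔐 φ pnf h =
  strategy em 𝔐 φ distinctBinders ,
  strategy-wins em 𝔐 φ distinctBinders
    -- The initial context is empty, so each free variable has to be unbound in `φ`.
    (tt , scoped em φ wellFormed (inj₂ ∘ freeNotBound) (λ ()) , (λ _ _ _ _ → id) , h)
  where open Classical.PositiveNormalForm pnf
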